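{- Let $A$ be a finite alphabet with $|A|=k$, and let $L\subseteq A^*$ be $n$-PT. Let $m=f_k(n)$. Then ${\uparrow}L$ is $m$-PT, while ${\uparrow}_<L$ and $\min(L)$ are $(m+1)$-PT.
   Context: For words $u,v$, $u\sqsubseteq v$ (subword) means $u=a_1\cdots a_\ell$ with letters $a_i$ and $v=v_0a_1v_1\cdots a_\ell v_\ell$ for some words $v_i$; $u\sqsubset v$ means $u\sqsubseteq v$ and $u\ne v$. ${\uparrow}L=\{v\in A^*~|~\exists u\in L: u\sqsubseteq v\}$, ${\uparrow}_<L=\{v~|~\exists u\in L: u\sqsubset v\}$, and $\min(L)=\{u\in L~|~\forall v\in L: v\not\sqsubset u\}$. For $n\in\mathbb{N}$, $u\sim_n v$ iff $u$ and $v$ have exactly the same subwords of length at most $n$; $L$ is $n$-PT if it is a union of $\sim_n$-classes. The functions $f_k$ ($k\geq1$) are defined by $f_1(n)=n$ and $f_{k+1}(n)=\max_{0\leq m\leq n}\bigl(m f_k(n+1-m)+m+f_k(n-m)\bigr)$. -}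

module Defs where

open import Data.List.Base using (List; length; map; upTo)
open import Data.List.Extrema.Nat using (max)
open import Data.List.Relation.Binary.Sublist.Propositional using (_⊆_)
open import Data.Nat.Base using (ℕ; suc; NonZero; _+_; _*_; _∸_; _≤_)
open import Data.Product.Base using (Σ-syntax; ∃-syntax; _×_)
open import Function.Bundles using (_⇔_)
open import Level using (Level; _⊔_) renaming (suc to lsuc)
open import Relation.Binary.Core using (Rel)
open import Relation.Binary.PropositionalEquality.Core using (_≢_)
open import Relation.Nullary.Negation.Core using (¬_)
open import Relation.Unary using (Pred; _∈_; _≐_; ⋃)

private
  variable
    a ℓ : Level
    A : Set a

-- A word is a list of letters, a language a predicate on words, and the
-- subword ordering is the propositional sublist relation _⊆_.

infix 4 _⊏_ _∼[_]_

_⊏_ : Rel (List A) _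
u ⊏ v = u ⊆ v × u ≢ v

↑_ : Pred (List A) ℓ → Pred (List A) _
(↑ L) v = ∃[ u ] u ∈ L × u ⊆ v

↑<_ : Pred (List A) ℓ → Pred (List A) _
(↑< L) v = ∃[ u ] u ∈ L × u ⊏ v

min : Pred (List A) ℓ → Pred (List A) _
min L u = u ∈ L × (∀ v → v ∈ L → ¬ (v ⊏ u))

_∼[_]_ : List A → ℕ → List A → Set _
u ∼[ n ] v = ∀ w → length w ≤ n → w ⊆ u ⇔ w ⊆ v

-- L is a union of ∼ₙ-classes, the classes being given by a family of
-- representatives.  The level of I allows the family of all members of L.

PT : {A : Set a} → ℕ → Pred (List A) ℓ → Set (lsuc (a ⊔ ℓ))
PT {a = a} {ℓ = ℓ} {A = A} n L =
  Σ[ I ∈ Set (a ⊔ ℓ) ] Σ[ rep ∈ (I → List A) ]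
    L ≐ ⋃ I (λ i v → rep i ∼[ n ] v)

-- The subtractions are exact, since m ranges over 0, …, n; the default
-- value 0 of max is immaterial, since that range is never empty.

f : (k : ℕ) .{{_ : NonZero k}} → ℕ → ℕ
f 1             n = n
f (suc (suc k)) n =
  max 0 (map (λ m → m * f (suc k) (n + 1 ∸ m) + m + f (suc k) (n ∸ m))
             (upTo (suc n)))

{-# OPTIONS --safe #-}

-- Every word u over k letters has a subword u' ∼ₙ u of length at most f k n.
-- Factor u = x₁a₁⋯xₘaₘy, each xᵢaᵢ being the shortest prefix of what remains
-- in which the whole alphabet occurs, and stop after m = n such arches or as
-- soon as a letter is missing from the remainder y.  The xᵢ and y use one
-- letter less.  A word of length m embeds into any m arches, so xᵢ may be
-- shortened up to ∼ₙ₊₁₋ₘ and y up to ∼ₙ₋ₘ.  Summing the lengths gives the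
-- recurrence of f.  Hence ↑L, ↑<L and min L are determined by the members of L
-- of length at most f k n.

module Submission where

open import Defs
open import Data.Fin.Base using (Fin)
open import Data.Fin.Properties using (inj⇒≟)
open import Data.List.Base
  using (List; []; _∷_; [_]; _++_; length; map; take; drop; tabulate; upTo)
open import Data.List.Extrema.Nat using (v≤max⁺)
open import Data.List.Membership.Propositional using (_∈_; _∉_; find; lose)
open import Data.List.Membership.Propositional.Properties
  using (∈-++⁺ˡ; ∈-++⁺ʳ; ∈-++⁻; ∈-∃++; ∈-map⁺; ∈-upTo⁺; ∈-tabulate⁺)
open import Data.List.Properties
  using (++-assoc; ∷ʳ-++; ≡-dec; length-++; length-++-sucʳ; length-take; length-drop;
         length-tabulate; take++drop≡id)
open import Data.List.Relation.Binary.Sublist.Propositional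
  using (_⊆_; []; _∷_; _∷ʳ_; ⊆-refl; ⊆-trans; ⊆-antisym; minimum; from∈)
open import Data.List.Relation.Binary.Sublist.Propositional.Properties
  using (All-resp-⊆; ++⁺; length-mono-≤)
import Data.List.Relation.Binary.Sublist.Heterogeneous.Properties as Sublist
open import Data.List.Relation.Unary.All as All using (All; []; _∷_; all?)
open import Data.List.Relation.Unary.All.Properties as Allₚ using (¬All⇒Any¬)
open import Data.List.Relation.Unary.Any using (here; there)
open import Data.Nat.Base
  using (ℕ; zero; suc; NonZero; _+_; _*_; _∸_; _≤_; z≤n; s≤s)
open import Data.Nat.Properties
  using (≤-refl; ≤-reflexive; ≤-trans; ≤-total; <⇒≤; 1+n≰n; suc-injective; +-assoc;
         +-comm; +-mono-≤; +-monoˡ-≤; +-monoʳ-≤; *-zeroʳ; m≤m+n; m+n∸m≡n; m⊓n≤m;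
         m≤n+o⇒m∸n≤o; module ≤-Reasoning)
open import Data.Nat.Tactic.RingSolver using (solve-∀)
open import Data.Product.Base using (∃; ∃₂; ∃-syntax; _×_; _,_; proj₂)
open import Data.Sum.Base using (inj₁; inj₂)
open import Function.Base using (_∘_; id)
open import Function.Bundles using (_↔_; mk⇔; module Equivalence; module Inverse)
open import Function.Properties.Inverse using (↔⇒↣)
open import Level using (Level)
open import Relation.Binary.Definitions using (DecidableEquality)
open import Relation.Binary.PropositionalEquality hiding ([_])
open import Relation.Nullary using (yes; no; contradiction)
open import Relation.Unary using (Pred)

private
  variable
    a ℓ : Level
    A : Set a
    S u v w x y y' z : List A
    m n p q r : ℕ

-- One-sided comparison of words, and universal words.

infix 4 _≲[_]_

-- Half of `u ∼[ n ] v`. The other half is automatic if `v ⊆ u`, so that shortening a word has to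
-- control this half only.
_≲[_]_ : List A → ℕ → List A → Set _
u ≲[ n ] v = ∀ w → length w ≤ n → w ⊆ u → w ⊆ v

∼⇒≲ : u ∼[ n ] v → u ≲[ n ] v
∼⇒≲ u∼v w w≤n = Equivalence.to (u∼v w w≤n)

∼⇒≳ : u ∼[ n ] v → v ≲[ n ] u
∼⇒≳ u∼v w w≤n = Equivalence.from (u∼v w w≤n)

≲-weaken : m ≤ n → u ≲[ n ] v → u ≲[ m ] v
≲-weaken m≤n u≲v w w≤m = u≲v w (≤-trans w≤m m≤n)

≲-trans : u ≲[ n ] v → v ≲[ n ] w → u ≲[ n ] w
≲-trans u≲v v≲w t t≤n = v≲w t t≤n ∘ u≲v t t≤n

Over : List A → List A → Set _
Over S u = All (_∈ S) u

-- Known as `p`-universality, or `p`-richness, over the alphabet `S`.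
Universal : List A → ℕ → List A → Set _
Universal S p x = ∀ w → Over S w → length w ≤ p → w ⊆ x

universal-zero : Universal S 0 x
universal-zero [] _ _ = minimum _

universal-one : All (_∈ x) S → Universal S 1 x
universal-one S⊆x []      _          _ = minimum _
universal-one S⊆x (b ∷ []) (b∈S ∷ _) _ = from∈ (All.lookup S⊆x b∈S)
universal-one S⊆x (b ∷ _ ∷ _) _ (s≤s ())

universal-resp-≲ : x ≲[ p ] y → Universal S p x → Universal S p y
universal-resp-≲ x≲y ux w w∈S w≤p = x≲y w w≤p (ux w w∈S w≤p)

-- Cutting words and replacing factors.

length-take-≤ : ∀ n (w : List A) → length (take n w) ≤ n
length-take-≤ n w = ≤-trans (≤-reflexive (length-take n w)) (m⊓n≤m n _)

length-drop-≤ : ∀ m (w : List A) → length w ≤ m + n → length (drop m w) ≤ n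
length-drop-≤ m w w≤ =
  ≤-trans (≤-reflexive (length-drop m w)) (m≤n+o⇒m∸n≤o (length w) m w≤)

take-mono-⊆ : ∀ (w : List A) → m ≤ n → take m w ⊆ take n w
take-mono-⊆ w       z≤n       = minimum _
take-mono-⊆ []      (s≤s _)   = []
take-mono-⊆ (b ∷ w) (s≤s m≤n) = refl ∷ take-mono-⊆ w m≤n

drop-anti-⊆ : ∀ (w : List A) → m ≤ n → drop n w ⊆ drop m w
drop-anti-⊆ w m≤n = Sublist.drop⁺ m≤n ⊆-refl

-- The cut is given by its position, which can then be compared with a level and moved.
⊆-split : ∀ x → w ⊆ x ++ y → ∃[ i ] take i w ⊆ x × drop i w ⊆ y
⊆-split []      w⊆y = 0 , [] , w⊆y
⊆-split (b ∷ x) (.b ∷ʳ w⊆) with ⊆-split x w⊆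
... | i , l , r = i , b ∷ʳ l , r
⊆-split (b ∷ x) (refl ∷ w⊆) with ⊆-split x w⊆
... | i , l , r = suc i , refl ∷ l , r

⊆-join : ∀ i → take i w ⊆ x → drop i w ⊆ y → w ⊆ x ++ y
⊆-join {w = w} i l r = subst (_⊆ _) (take++drop≡id i w) (++⁺ l r)

universal-++ : Universal S p x → Universal S q y → Universal S (p + q) (x ++ y)
universal-++ {p = p} ux uy w w∈S w≤ = ⊆-join p
  (ux _ (Allₚ.take⁺ p w∈S) (length-take-≤ p w))
  (uy _ (Allₚ.drop⁺ p w∈S) (length-drop-≤ p w w≤))

-- A universal factor absorbs its full share of letters in some embedding of w,
-- so at most r letters are left to the factor being replaced.
++-monoʳ-≲ : n ≤ p + r → Universal S p x → Over S (x ++ y) →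
             y ≲[ r ] y' → x ++ y ≲[ n ] x ++ y'
++-monoʳ-≲ {p = p} {x = x} n≤ ux xy∈S y≲y' w w≤n w⊆ with ⊆-split x w⊆
... | i , l , r with ≤-total i p
...   | inj₁ i≤p = ⊆-join p
        (ux _ (Allₚ.take⁺ p (All-resp-⊆ w⊆ xy∈S)) (length-take-≤ p w))
        (y≲y' _ (length-drop-≤ p w (≤-trans w≤n n≤)) (⊆-trans (drop-anti-⊆ w i≤p) r))
...   | inj₂ p≤i = ⊆-join i l
        (y≲y' _ (length-drop-≤ i w (≤-trans w≤n (≤-trans n≤ (+-monoˡ-≤ _ p≤i)))) r)

++-monoˡ-≲ : n ≤ r + q → Universal S q z → Over S (y ++ z) →
             y ≲[ r ] y' → y ++ z ≲[ n ] y' ++ z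
++-monoˡ-≲ {r = r} {y = y} n≤ uz yz∈S y≲y' w w≤n w⊆ with ⊆-split y w⊆
... | i , l , d with ≤-total i r
...   | inj₁ i≤r = ⊆-join i (y≲y' _ (≤-trans (length-take-≤ i w) i≤r) l) d
...   | inj₂ r≤i = ⊆-join r
        (y≲y' _ (length-take-≤ r w) (⊆-trans (take-mono-⊆ w r≤i) l))
        (uz _ (Allₚ.drop⁺ r (All-resp-⊆ w⊆ yz∈S)) (length-drop-≤ r w (≤-trans w≤n n≤)))

-- Only one occurrence of `b` is dropped: `S` may repeat letters, and the induction is on its
-- length.
∈-remove : ∀ {b : A} {k} → length S ≡ suc k → b ∈ S →
           ∃[ T ] length T ≡ k × (∀ u → b ∉ u → Over S u → Over T u)
∈-remove {b = b} |S| b∈S with ∈-∃++ b∈S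
... | ys , zs , refl =
  ys ++ zs , suc-injective (trans (sym (length-++-sucʳ ys b zs)) |S|) ,
  λ u b∉u u∈S → All.tabulate λ {c} c∈u →
    keep (λ { refl → b∉u c∈u }) (∈-++⁻ ys (All.lookup u∈S c∈u))
  where
  keep : ∀ {c} → c ≢ b → _ → c ∈ ys ++ zs
  keep c≢b (inj₁ c∈ys)         = ∈-++⁺ˡ c∈ys
  keep c≢b (inj₂ (here c≡b))   = contradiction c≡b c≢b
  keep c≢b (inj₂ (there c∈zs)) = ∈-++⁺ʳ ys c∈zs

Condensable : List A → (ℕ → ℕ) → Set _
Condensable S g = ∀ n u → Over S u → ∃[ u' ] u' ⊆ u × u ≲[ n ] u' × length u' ≤ g n

-- The first arch of a word.

module _ {A : Set a} (_≟_ : DecidableEquality A) where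

  open import Data.List.Membership.DecPropositional _≟_ using (_∈?_)

  first-occurrence : ∀ {b : A} {u} → b ∈ u → ∃₂ λ x y → u ≡ x ++ b ∷ y × b ∉ x
  first-occurrence {b} {c ∷ u} b∈ with b ≟ c
  ... | yes refl = [] , u , refl , λ ()
  ... | no b≢c with first-occurrence (tail b∈)
    where
    tail : b ∈ c ∷ u → b ∈ u
    tail (here b≡c)  = contradiction b≡c b≢c
    tail (there b∈u) = b∈u
  ...   | x , y , refl , b∉x =
    c ∷ x , y , refl , λ { (here b≡c) → b≢c b≡c ; (there b∈x) → b∉x b∈x }

  -- Induction on the letters: the arch of the remaining letters is kept if it contains `s`, and
  -- otherwise runs on to the first `s` after it. Either way its last letter is new, so that `x`
  -- uses one letter less.
  first-arch : ∀ s (S : List A) {u} → All (_∈ u) (s ∷ S) →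
               ∃₂ λ x b → ∃[ y ] u ≡ x ++ b ∷ y × b ∈ s ∷ S × b ∉ x ×
                                 All (_∈ x ++ [ b ]) (s ∷ S)
  first-arch s [] (s∈u ∷ []) with first-occurrence s∈u
  ... | x , y , u≡ , s∉x = x , s , y , u≡ , here refl , s∉x , ∈-++⁺ʳ x (here refl) ∷ []
  first-arch s (t ∷ S) (s∈u ∷ S⊆u) with first-arch t S S⊆u
  ... | x , b , y , refl , b∈S , b∉x , S⊆xb with s ∈? (x ++ [ b ])
  ...   | yes s∈xb = x , b , y , refl , there b∈S , b∉x , s∈xb ∷ S⊆xb
  ...   | no s∉xb
    with ∈-++⁻ (x ++ [ b ]) (subst (s ∈_) (sym (∷ʳ-++ x b y)) s∈u)
  ...     | inj₁ s∈xb = contradiction s∈xb s∉xb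
  ...     | inj₂ s∈y with first-occurrence s∈y
  ...       | x₂ , y₂ , refl , s∉x₂ =
    (x ++ [ b ]) ++ x₂ , s , y₂ , u≡ , here refl , s∉ ,
    ∈-++⁺ʳ ((x ++ [ b ]) ++ x₂) (here refl) ∷ All.map (∈-++⁺ˡ ∘ ∈-++⁺ˡ) S⊆xb
    where
    u≡ : x ++ b ∷ x₂ ++ s ∷ y₂ ≡ ((x ++ [ b ]) ++ x₂) ++ s ∷ y₂
    u≡ = trans (sym (∷ʳ-++ x b _)) (sym (++-assoc (x ++ [ b ]) x₂ _))
    s∉ : s ∉ (x ++ [ b ]) ++ x₂
    s∉ s∈ with ∈-++⁻ (x ++ [ b ]) s∈
    ... | inj₁ s∈xb = s∉xb s∈xb
    ... | inj₂ s∈x₂ = s∉x₂ s∈x₂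

  -- Shortening arch by arch.

  module _ {k g} (condense : ∀ (S : List A) → length S ≡ k → Condensable S g) where

    -- m is the number of arches and r = n − m.  The factors are shortened at
    -- the levels r + 1 and r, which depend only on the final value of r.
    condense-arches : ∀ S → length S ≡ suc k → ∀ n u → Over S u →
      ∃₂ λ m r → ∃[ u' ] m + r ≡ n × u' ⊆ u × u ≲[ n ] u' × Universal S m u' ×
                         length u' ≤ m * g (suc r) + m + g r
    condense-arches S |S| zero u u∈S =
      0 , 0 , [] , refl , minimum _ , (λ { [] _ _ → [] }) , universal-zero , z≤n
    condense-arches (s ∷ S) |S| (suc n) u u∈S with all? (_∈? u) (s ∷ S)
    ... | no S⊈u
      with b , b∈S , b∉u ← find (¬All⇒Any¬ (_∈? u) (s ∷ S) S⊈u)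
      with T , |T| , over ← ∈-remove |S| b∈S
      with u' , u'⊆u , u≲u' , u'≤ ← condense T |T| (suc n) u (over u b∉u u∈S)
      = 0 , suc n , u' , refl , u'⊆u , u≲u' , universal-zero , u'≤
    ... | yes S⊆u
      with x , b , y , refl , b∈S , b∉x , S⊆xb ← first-arch s S S⊆u
      with x∈S , b∈S ∷ y∈S ← Allₚ.++⁻ x u∈S
      with m , r , y' , refl , y'⊆y , y≲y' , uy' , y'≤ ← condense-arches (s ∷ S) |S| n y y∈S
      with T , |T| , over ← ∈-remove |S| b∈S
      -- The rest is treated first, because its outcome `r` sets the level for `x`.
      with x' , x'⊆x , x≲x' , x'≤ ← condense T |T| (suc r) x (over x b∉x x∈S)
      = suc m , r , x' ++ b ∷ y' , refl , ++⁺ x'⊆x (refl ∷ y'⊆y)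
      , ≲-trans replace-y replace-x , universal , bound
      where
      S⁺ = s ∷ S

      by∈S : Over S⁺ (b ∷ y')
      by∈S = b∈S ∷ All-resp-⊆ y'⊆y y∈S

      universal-xb : Universal S⁺ 1 (x ++ [ b ])
      universal-xb = universal-one S⊆xb

      -- The arch absorbs one letter and leaves `m + r` to the rest.
      replace-y : x ++ b ∷ y ≲[ suc (m + r) ] x ++ b ∷ y'
      replace-y = subst₂ (_≲[ suc (m + r) ]_) (∷ʳ-++ x b y) (∷ʳ-++ x b y')
        (++-monoʳ-≲ ≤-refl universal-xb (subst (Over S⁺) (sym (∷ʳ-++ x b y)) u∈S) y≲y')

      -- The universal word `y'` absorbs `m` letters and leaves `suc r` to `x`.
      replace-x : x ++ b ∷ y' ≲[ suc (m + r) ] x' ++ b ∷ y'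
      replace-x = ++-monoˡ-≲ (≤-reflexive (cong suc (+-comm m r)))
        (λ w w∈S w≤m → b ∷ʳ uy' w w∈S w≤m) (Allₚ.++⁺ x∈S by∈S) x≲x'

      -- As `suc r` is at least 1, `x'` keeps every letter of `x`, and the shortened arch still
      -- contains the whole alphabet.
      replace-xb : x ++ [ b ] ≲[ 1 ] x' ++ [ b ]
      replace-xb = ++-monoˡ-≲ {S = S⁺} ≤-refl universal-zero (Allₚ.++⁺ x∈S (b∈S ∷ []))
        (≲-weaken (s≤s z≤n) x≲x')

      universal : Universal S⁺ (suc m) (x' ++ b ∷ y')
      universal = subst (Universal S⁺ (suc m)) (∷ʳ-++ x' b y')
        (universal-++ (universal-resp-≲ replace-xb universal-xb) uy')

      rearrange : ∀ m p q → p + suc (m * p + m + q) ≡ suc m * p + suc m + q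
      rearrange = solve-∀

      bound : length (x' ++ b ∷ y') ≤ suc m * g (suc r) + suc m + g r
      bound = begin
        length (x' ++ b ∷ y')                          ≡⟨ length-++ x' ⟩
        length x' + suc (length y')                    ≤⟨ +-mono-≤ x'≤ (s≤s y'≤) ⟩
        g (suc r) + suc (m * g (suc r) + m + g r)      ≡⟨ rearrange m (g (suc r)) (g r) ⟩
        suc m * g (suc r) + suc m + g r                ∎
        where open ≤-Reasoning

    -- Stated for every `h` that dominates the bound, since `f 1` is given outright and not as a
    -- maximum.
    condense-suc : ∀ h → (∀ m r → m * g (suc r) + m + g r ≤ h (m + r)) →
                   ∀ S → length S ≡ suc k → Condensable S h
    condense-suc h g≤h S |S| n u u∈S
      with m , r , u' , refl , u'⊆u , u≲u' , _ , u'≤ ← condense-arches S |S| n u u∈S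
      = u' , u'⊆u , u≲u' , ≤-trans u'≤ (g≤h m r)

  -- The left side is the term of index `m` in the maximum at `n = m + r`.
  f-recurrence : ∀ k m r → m * f (suc k) (suc r) + m + f (suc k) r ≤ f (suc (suc k)) (m + r)
  f-recurrence k m r = v≤max⁺ 0 _ (inj₂ (lose (∈-map⁺ _ (∈-upTo⁺ (s≤s (m≤m+n m r))))
    (≤-reflexive (cong₂ (λ i j → m * f (suc k) i + m + f (suc k) j)
      (sym (trans (cong (_∸ m) (+-assoc m r 1)) (trans (m+n∸m≡n m (r + 1)) (+-comm r 1))))
      (sym (m+n∸m≡n m r))))))

  condense-over : ∀ k (S : List A) → length S ≡ suc k → Condensable S (f (suc k))
  -- Over a single letter the factors between the arches are empty, and only the `m` closing letters
  -- count.
  condense-over zero = condense-suc condense-empty id linear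
    where
    condense-empty : ∀ (S : List A) → length S ≡ 0 → Condensable S (λ _ → 0)
    condense-empty [] _ n []      _        = [] , [] , (λ _ _ → id) , z≤n
    condense-empty [] _ n (_ ∷ _) (() ∷ _)

    linear : ∀ m r → m * 0 + m + 0 ≤ m + r
    linear m r rewrite *-zeroʳ m = +-monoʳ-≤ m z≤n
  condense-over (suc k) = condense-suc (condense-over k) (f (suc (suc k))) (f-recurrence k)

-- Strict subwords.

⊆-⊏-trans : u ⊆ v → v ⊏ w → u ⊏ w
⊆-⊏-trans u⊆v (v⊆w , v≢w) = ⊆-trans u⊆v v⊆w , λ { refl → v≢w (⊆-antisym v⊆w u⊆v) }

-- The first letter of `v` that the embedding skips is inserted into `u`.
⊏-extend : u ⊆ v → u ≢ v → ∃[ w ] u ⊆ w × w ⊆ v × length w ≡ suc (length u)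
⊏-extend []           u≢v = contradiction refl u≢v
⊏-extend (b ∷ʳ u⊆v)   u≢v = _ , b ∷ʳ ⊆-refl , refl ∷ u⊆v , refl
⊏-extend (refl ∷ u⊆v) u≢v with ⊏-extend u⊆v (u≢v ∘ cong (_ ∷_))
... | w , u⊆w , w⊆v , |w| = _ ∷ w , refl ∷ u⊆w , refl ∷ w⊆v , cong suc |w|

-- A subword of `v` that extends `u` by one letter carries over to `w`, and is too long to embed
-- into `u`. This is the source of the 1 in `m + 1`.
⊏-resp-≲ : suc (length u) ≤ n → v ≲[ n ] w → u ⊏ v → u ⊏ w
⊏-resp-≲ {u = u} u<n v≲w (u⊆v , u≢v) with ⊏-extend u⊆v u≢v
... | t , u⊆t , t⊆v , |t| = ⊆-trans u⊆t t⊆w , λ { refl → 1+n≰n (t≤u t⊆w) }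
  where
  t⊆w : t ⊆ _
  t⊆w = v≲w t (≤-trans (≤-reflexive |t|) u<n) t⊆v
  t≤u : t ⊆ u → suc (length u) ≤ length u
  t≤u t⊆u = ≤-trans (≤-reflexive (sym |t|)) (length-mono-≤ t⊆u)

-- Unions of classes as invariant languages.

PT⇒resp : {L : Pred (List A) ℓ} → PT n L → u ∼[ n ] v → L u → L v
PT⇒resp (I , rep , L⊆⋃ , ⋃⊆L) u∼v u∈L with L⊆⋃ u∈L
... | i , rep∼u = ⋃⊆L (i , λ w w≤n → mk⇔
  (∼⇒≲ u∼v w w≤n ∘ ∼⇒≲ rep∼u w w≤n)
  (∼⇒≳ rep∼u w w≤n ∘ ∼⇒≳ u∼v w w≤n))

resp⇒PT : {L : Pred (List A) ℓ} → (∀ {u v} → u ∼[ n ] v → L u → L v) → PT n L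
resp⇒PT {L = L} resp =
  ∃ L , (λ (u , _) → u) ,
  (λ u∈L → (_ , u∈L) , λ _ _ → mk⇔ id id) ,
  (λ ((u , u∈L) , u∼v) → resp u∼v u∈L)

-- Languages in which every member contains a short member.

module _ {A : Set a} (_≟_ : DecidableEquality A) {L : Pred (List A) ℓ}
         (condense : ∀ {u} → L u → ∃[ u' ] u' ⊆ u × L u' × length u' ≤ m) where

  ↑-PT : PT m (↑ L)
  ↑-PT = resp⇒PT λ v∼v' (u , u∈L , u⊆v) →
    let u' , u'⊆u , u'∈L , u'≤m = condense u∈L
    in  u' , u'∈L , ∼⇒≲ v∼v' u' u'≤m (⊆-trans u'⊆u u⊆v)

  ↑<-PT : PT (m + 1) (↑< L)
  ↑<-PT = resp⇒PT λ v∼v' (u , u∈L , u⊏v) →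
    let u' , u'⊆u , u'∈L , u'≤m = condense u∈L
    in  u' , u'∈L ,
        ⊏-resp-≲ (≤-trans (s≤s u'≤m) (≤-reflexive (+-comm 1 m))) (∼⇒≲ v∼v')
          (⊆-⊏-trans u'⊆u u⊏v)

  -- A minimal word equals its own shortening, so its length is at most `m`. Its class at level
  -- `m + 1` is then a singleton: for another member `v`, `u ⊏ v` would carry over to `u ⊏ u`.
  min-PT : PT (m + 1) (min L)
  min-PT = resp⇒PT min-resp
    where
    short : ∀ {u} → min L u → length u ≤ m
    short {u} (u∈L , minimal) with condense u∈L
    ... | u' , u'⊆u , u'∈L , u'≤m with ≡-dec _≟_ u' u
    ...   | yes refl  = u'≤m
    ...   | no  u'≢u = contradiction (u'⊆u , u'≢u) (minimal u' u'∈L)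

    min-resp : ∀ {u v} → u ∼[ m + 1 ] v → min L u → min L v
    min-resp {u} {v} u∼v u∈min with ≡-dec _≟_ u v
    ... | yes refl = u∈min
    ... | no  u≢v = contradiction refl (proj₂ (⊏-resp-≲ u<m+1 (∼⇒≳ u∼v) (u⊆v , u≢v)))
      where
      u<m+1 : suc (length u) ≤ m + 1
      u<m+1 = ≤-trans (s≤s (short u∈min)) (≤-reflexive (+-comm 1 m))
      u⊆v : u ⊆ v
      u⊆v = ∼⇒≲ u∼v u (<⇒≤ u<m+1) ⊆-refl

theorem11 : ∀ {a ℓ} {A : Set a} (k : ℕ) .{{_ : NonZero k}} → A ↔ Fin k →
    (n : ℕ) (L : Pred (List A) ℓ) → PT n L →
    let m = f k n in
    PT m (↑ L) × PT (m + 1) (↑< L) × PT (m + 1) (min L)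
theorem11 {A = A} (suc k) A↔Fin n L L-PT =
  ↑-PT _≟_ condense , ↑<-PT _≟_ condense , min-PT _≟_ condense
  where
  open Inverse A↔Fin using (to; from; strictlyInverseʳ)

  _≟_ : DecidableEquality A
  _≟_ = inj⇒≟ (↔⇒↣ A↔Fin)

  alphabet : List A
  alphabet = tabulate from

  ∈-alphabet : ∀ b → b ∈ alphabet
  ∈-alphabet b = subst (_∈ alphabet) (strictlyInverseʳ b) (∈-tabulate⁺ {f = from} (to b))

  condense : ∀ {u} → L u → ∃[ u' ] u' ⊆ u × L u' × length u' ≤ f (suc k) n
  condense {u} u∈L
    with u' , u'⊆u , u≲u' , u'≤ ← condense-over _≟_ k alphabet (length-tabulate from)
           n u (All.universal ∈-alphabet u)
    = u' , u'⊆u , PT⇒resp L-PT u∼u' u∈L , u'≤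
    where
    u∼u' : u ∼[ n ] u'
    u∼u' w w≤n = mk⇔ (u≲u' w w≤n) (λ w⊆u' → ⊆-trans w⊆u' u'⊆u)
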